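{- Let $\mathcal{L}=(L,\wedge,\vee,*,\rightarrowtail,0,1)$ be a BL-algebra. Then the family $T_*$ of all $*$-open subsets of $L$ is a topology on $L$, and the family $\mathbf{T}_*$ of all $*$-open subsets of $L^2$ is a topology on $L^2$.
   Context: A BL-algebra is an algebra $\mathcal{L}=(L,\wedge,\vee,*,\rightarrowtail,0,1)$ of type $(2,2,2,2,0,0)$ such that: (BL1) $(L,\wedge,\vee,0,1)$ is a bounded lattice with greatest element $1$ and smallest element $0$; (BL2) $(L,*,1)$ is an Abelian monoid; (BL3) $c\le a\rightarrowtail b$ iff $c*a\le b$ for all $a,b,c\in L$; (BL4) $a\wedge b=a*(a\rightarrowtail b)$ for all $a,b\in L$; (BL5) $(a\rightarrowtail b)\vee(b\rightarrowtail a)=1$ for all $a,b\in L$. An element $a\in L$ is strongly less than $1$, written $a\ll 1$, if for every $b\in L$, $a\vee b=1$ implies $b=1$. Elements of $L^2$ are written $\mathbf{a}=(a_1,a_2)$. Define $a\leftrightarrow b=(a\rightarrowtail b)*(b\rightarrowtail a)$ for $a,b\in L$ and $\mathbf{a}\Leftrightarrow\mathbf{b}=(a_1\leftrightarrow b_1)*(a_2\leftrightarrow b_2)$ for $\mathbf{a},\mathbf{b}\in L^2$. For $r\in L$ with $r\ll 1$, $a\in L$ and $\mathbf{a}\in L^2$, the $*$-balls are $B_r(a)=\{b\in L: a\leftrightarrow b>r\}$ and $\mathbf{B}_r(\mathbf{a})=\{\mathbf{b}\in L^2:\mathbf{a}\Leftrightarrow\mathbf{b}>r\}$ (where $x>r$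 means $r\le x$ and $r\neq x$). A subset $G\subseteq L$ is $*$-open if for every $a\in G$ there exists $r\in L$ with $r\ll 1$ and $B_r(a)\subseteq G$. A subset $G\subseteq L^2$ is $*$-open if for every $\mathbf{a}\in G$ there exists $r\in L$ with $r\ll 1$ and $\mathbf{B}_r(\mathbf{a})\subseteq G$. -}

module Defs where

open import Algebra.Core using (Op₂)
open import Algebra.Definitions using (Congruent₂)
open import Algebra.Lattice.Structures using (IsLattice)
open import Algebra.Structures using (IsCommutativeMonoid)
open import Data.Product using (_×_; _,_; ∃-syntax)
open import Data.Product.Relation.Binary.Pointwise.NonDependent using (×-setoid)
open import Function.Bundles using (_⇔_)
open import Level using (Level; Setω; _⊔_; suc)
open import Relation.Binary.Bundles using (Setoid)
open import Relation.Binary.Core using (Rel)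
open import Relation.Binary.Definitions using (Maximum; Minimum; _Respects_)
import Relation.Binary.Construct.NaturalOrder.Left as NaturalOrder
import Relation.Binary.Construct.NonStrictToStrict as Strict
open import Relation.Unary using (Pred; ∅; U; _∈_; _⊆_; _≐_; _∩_; ⋃)

record BLAlgebra (c e : Level) : Set (suc (c ⊔ e)) where
  infix  4 _≈_
  infixr 7 _∧_
  infixr 6 _∨_
  infixl 7 _*_
  infixr 5 _↣_
  field
    Carrier : Set c
    _≈_     : Rel Carrier e
    _∧_ _∨_ _*_ _↣_ : Op₂ Carrier
    0# 1#   : Carrier

  -- The lattice order: x ≤ y is x ≈ x ∧ y, and x < y is x ≤ y and not x ≈ y.
  open NaturalOrder _≈_ _∧_ public using (_≤_)
  open Strict _≈_ _≤_ public using (_<_)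

  field
    isLattice             : IsLattice _≈_ _∨_ _∧_
    0#-minimum            : Minimum _≤_ 0#
    1#-maximum            : Maximum _≤_ 1#
    *-isCommutativeMonoid : IsCommutativeMonoid _≈_ _*_ 1#
    -- ↣ is an operation on the setoid.
    ↣-cong                : Congruent₂ _≈_ _↣_
    residuation           : ∀ a b c → c ≤ (a ↣ b) ⇔ (c * a) ≤ b
    divisibility          : ∀ a b → a ∧ b ≈ a * (a ↣ b)
    prelinearity          : ∀ a b → (a ↣ b) ∨ (b ↣ a) ≈ 1#

  setoid : Setoid c e
  setoid = record { isEquivalence = IsLattice.isEquivalence isLattice }

  setoid² : Setoid c e
  setoid² = ×-setoid setoid setoid

-- Subsets of a setoid are predicates respecting its equality, considered up to
-- ≐.  A family T of subsets is given at all universe levels at once, so that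
-- the union of an arbitrary indexed family of members, whatever the level of
-- its index type, is again a predicate to which T applies; in particular the
-- union of any subfamily S of T is covered, by taking as index type the type of
-- members of S.  This quantification over levels puts the record in Setω.
record IsTopology {x e t : Level} (X : Setoid x e)
                  (T : ∀ {ℓ} → Pred (Setoid.Carrier X) ℓ → Set (t ⊔ ℓ)) : Setω where
  open Setoid X
  field
    respects-≈ : ∀ {ℓ} {G : Pred Carrier ℓ} → T G → G Respects _≈_
    respects-≐ : ∀ {ℓ ℓ′} {G : Pred Carrier ℓ} {H : Pred Carrier ℓ′} →
                 G ≐ H → T G → T H
    ∅-open     : T ∅
    U-open     : T U
    ∩-open     : ∀ {ℓ ℓ′} {G : Pred Carrier ℓ} {H : Pred Carrier ℓ′} →
                 T G → T H → T (G ∩ H)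
    ⋃-open     : ∀ {ι ℓ} (I : Set ι) (G : I → Pred Carrier ℓ) →
                 (∀ i → T (G i)) → T (⋃ I G)

-- Conjunction for statements in Setω.
infixr 2 _×ω_
record _×ω_ (A B : Setω) : Setω where
  constructor _,ω_
  field
    fst : A
    snd : B

module _ {c e : Level} (𝓛 : BLAlgebra c e) where
  open BLAlgebra 𝓛

  StronglyLessThan1 : Pred Carrier (c ⊔ e)
  StronglyLessThan1 a = ∀ b → a ∨ b ≈ 1# → b ≈ 1#

  _↔_ : Op₂ Carrier
  a ↔ b = (a ↣ b) * (b ↣ a)

  _↔²_ : Carrier × Carrier → Carrier × Carrier → Carrier
  (a₁ , a₂) ↔² (b₁ , b₂) = (a₁ ↔ b₁) * (a₂ ↔ b₂)

  Ball : Carrier → Carrier → Pred Carrier e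
  Ball r a b = r < (a ↔ b)

  Ball² : Carrier → Carrier × Carrier → Pred (Carrier × Carrier) e
  Ball² r a b = r < (a ↔² b)

  -- In both definitions the first conjunct says that G is a subset of the
  -- setoid.
  *-Open : ∀ {ℓ} → Pred Carrier ℓ → Set (c ⊔ e ⊔ ℓ)
  *-Open G = G Respects _≈_ ×
    (∀ a → a ∈ G → ∃[ r ] (StronglyLessThan1 r × Ball r a ⊆ G))

  *-Open² : ∀ {ℓ} → Pred (Carrier × Carrier) ℓ → Set (c ⊔ e ⊔ ℓ)
  *-Open² G = G Respects (Setoid._≈_ setoid²) ×
    (∀ a → a ∈ G → ∃[ r ] (StronglyLessThan1 r × Ball² r a ⊆ G))

-- Balls shrink as the radius grows, and a join of elements strongly less than 1
-- is strongly less than 1, so the intersection of two open sets is open with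
-- the join of the two radii.  Neither fact depends on how the distance is
-- built, which treats L and L² at once.
module Submission where

open import Defs
open import Algebra.Lattice.Bundles using (Lattice)
import Algebra.Lattice.Properties.Lattice as LatticeProperties
open import Data.Product using (_×_; _,_; map; ∃-syntax)
open import Data.Unit using (tt)
open import Function.Base using (_∘_)
open import Level using (Level; _⊔_)
import Relation.Binary.Construct.NonStrictToStrict as Strict
open import Relation.Binary.Bundles using (Setoid)
open import Relation.Binary.Definitions using (Trans; _Respects_)
import Relation.Binary.Lattice as Order
import Relation.Binary.Lattice.Properties.BoundedJoinSemilattice as BoundedJoin
open import Relation.Unary using (Pred; _∈_; _⊆_)

module _ {c e : Level} (𝓛 : BLAlgebra c e) where
  open BLAlgebra 𝓛

  lattice : Lattice c e
  lattice = record { isLattice = isLattice }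

  boundedJoinSemilattice : Order.BoundedJoinSemilattice c e e
  boundedJoinSemilattice = record
    { isBoundedJoinSemilattice = record
      { isJoinSemilattice = Order.Lattice.isJoinSemilattice
          (LatticeProperties.∨-∧-orderTheoreticLattice lattice)
      ; minimum = 0#-minimum
      }
    }

  open Order.BoundedJoinSemilattice boundedJoinSemilattice
    using (x≤x∨y; y≤x∨y; antisym; trans; ≤-respˡ-≈; module Eq)

  -- Antisymmetry keeps the result strict: x ≤ y < z together with x ≈ z would force y ≈ z. This is
  -- what makes balls shrink.
  ≤-<-trans : Trans _≤_ _<_ _<_
  ≤-<-trans = Strict.≤-<-trans _≈_ _≤_ trans antisym ≤-respˡ-≈

  0#≪1 : StronglyLessThan1 𝓛 0#
  0#≪1 b 0∨b≈1 =
    Eq.trans (Eq.sym (BoundedJoin.identityˡ boundedJoinSemilattice b)) 0∨b≈1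

  -- After reassociating, `r≪1` strips r and leaves s ∨ b ≈ 1#; then `s≪1` strips s.
  ∨-≪1 : ∀ {r s} → StronglyLessThan1 𝓛 r → StronglyLessThan1 𝓛 s →
         StronglyLessThan1 𝓛 (r ∨ s)
  ∨-≪1 {r} {s} r≪1 s≪1 b r∨s∨b≈1 =
    s≪1 b (r≪1 (s ∨ b) (Eq.trans (Eq.sym (Lattice.∨-assoc lattice r s b)) r∨s∨b≈1))

  module _ {x e′ : Level} (X : Setoid x e′)
           (d : Setoid.Carrier X → Setoid.Carrier X → Carrier) where
    private module X = Setoid X

    Open : ∀ {ℓ} → Pred X.Carrier ℓ → Set (c ⊔ e ⊔ x ⊔ e′ ⊔ ℓ)
    Open G = G Respects X._≈_ ×
      (∀ a → a ∈ G → ∃[ r ] (StronglyLessThan1 𝓛 r × (λ b → r < d a b) ⊆ G))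

    Open-isTopology : IsTopology {t = c ⊔ e ⊔ x ⊔ e′} X Open
    Open-isTopology = record
      { respects-≈ = λ (resp , _) → resp
      ; respects-≐ = λ (G⊆H , H⊆G) (resp , ball) →
          (λ a≈b → G⊆H ∘ resp a≈b ∘ H⊆G) ,
          λ a a∈H → let r , r≪1 , B⊆G = ball a (H⊆G a∈H) in
            r , r≪1 , λ b∈B → G⊆H (B⊆G b∈B)
      ; ∅-open = (λ _ ()) , λ _ ()
      -- Any radius strongly less than 1 would do; `0#` is one that every algebra has.
      ; U-open = (λ _ _ → tt) , λ _ _ → 0# , 0#≪1 , λ _ → tt
      ; ∩-open = λ (respG , ballG) (respH , ballH) →
          (λ a≈b → map (respG a≈b) (respH a≈b)) ,
          λ a (a∈G , a∈H) →
            let r , r≪1 , B⊆G = ballG a a∈G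
                s , s≪1 , B⊆H = ballH a a∈H
            in r ∨ s , ∨-≪1 r≪1 s≪1 , λ b∈B →
              B⊆G (≤-<-trans (x≤x∨y r s) b∈B) ,
              B⊆H (≤-<-trans (y≤x∨y r s) b∈B)
      ; ⋃-open = λ I G G-open →
          (λ a≈b (i , a∈Gi) → let resp , _ = G-open i in i , resp a≈b a∈Gi) ,
          -- The radius comes from the one member `G i` known to contain a.
          λ a (i , a∈Gi) →
            let _ , ball = G-open i
                r , r≪1 , B⊆Gi = ball a a∈Gi
            in r , r≪1 , λ b∈B → i , B⊆Gi b∈B
      }

theorem3p5 : ∀ {c e : Level} (𝓛 : BLAlgebra c e) →
    IsTopology {t = c ⊔ e} (BLAlgebra.setoid 𝓛) (*-Open 𝓛) ×ω
    IsTopology {t = c ⊔ e} (BLAlgebra.setoid² 𝓛) (*-Open² 𝓛)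
theorem3p5 𝓛 =
  -- At these two distances `Open` unfolds to `*-Open` and `*-Open²`.
  Open-isTopology 𝓛 (BLAlgebra.setoid 𝓛) (_↔_ 𝓛) ,ω
  Open-isTopology 𝓛 (BLAlgebra.setoid² 𝓛) (_↔²_ 𝓛)
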